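{- Let $\ell \geq 1$ be an integer and let $H_\ell$ be the graph defined in the context. Then every path in $H_\ell$ has length (number of edges) at most $2\ell^2+4\ell+7$.
   Context: For an integer $\ell\ge 1$, $H_\ell$ is the graph with vertex set $V_\ell=\{v_{h,j} : h\in\{ -\ell,\dots,\ell\},\ j\in\{1,\dots,2^{\ell-|h|}\}\}$ and with the following edges: (1) $v_{h,j}v_{h-1,2j-1}$ and $v_{h,j}v_{h-1,2j}$ for every $h\in\{1,\dots,\ell\}$ and $j\in\{1,\dots,2^{\ell-h}\}$; (2) $v_{h,j}v_{h+1,2j-1}$ and $v_{h,j}v_{h+1,2j}$ for every $h\in\{ -\ell,\dots,-1\}$ and $j\in\{1,\dots,2^{\ell-|h|}\}$; (3) the edge $v_{\ell,1}v_{ -\ell,1}$; (4) the edges $v_{0,2j-1}v_{0,2j}$ for every $j\in\{1,\dots,2^{\ell-1}\}$. Thus $H_\ell$ consists of two complete binary trees of height $\ell$ (rooted at $v_{\ell,1}$ and $v_{ -\ell,1}$) whose leaves $v_{0,j}$ are identified, plus an edge between the roots and a perfect matching on consecutive leaves. -}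

module Defs where

open import Data.Integer as ℤ using (ℤ; +_; -_; ∣_∣; 0ℤ; 1ℤ; -1ℤ)
open import Data.List.Base as List using (List; _∷_)
open import Data.List.Relation.Unary.Linked using (Linked)
open import Data.List.Relation.Unary.Unique.Propositional using (Unique)
open import Data.Nat.Base using (ℕ; _*_; _∸_; _^_; _≤_)
open import Level using (0ℓ)
open import Relation.Binary.Construct.Closure.Symmetric using (SymClosure)
open import Relation.Binary.Core using (Rel)
open import Relation.Binary.PropositionalEquality.Core using (_≡_)

-- The bounds are irrelevant, so that vertices are equal as soon as their
-- coordinates are.
record Vertex (ℓ : ℕ) : Set where
  constructor vertex
  field
    h    : ℤ
    j    : ℕ
    .-ℓ≤h : - (+ ℓ) ℤ.≤ h
    .h≤ℓ  : h ℤ.≤ + ℓ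
    .1≤j  : 1 ≤ j
    .j≤   : j ≤ 2 ^ (ℓ ∸ ∣ h ∣)

open Vertex public using (h; j)

-- Each edge in one orientation.  The ranges of h and j not listed in a
-- constructor are those imposed by `Vertex`.  All truncated subtractions here
-- and above are exact when 1 ≤ ℓ.
data Edge (ℓ : ℕ) (u w : Vertex ℓ) : Set where
  upper₁ : 1ℤ ℤ.≤ h u → h w ≡ h u ℤ.- 1ℤ → j w ≡ 2 * j u ∸ 1 → Edge ℓ u w
  upper₂ : 1ℤ ℤ.≤ h u → h w ≡ h u ℤ.- 1ℤ → j w ≡ 2 * j u     → Edge ℓ u w
  lower₁ : h u ℤ.≤ -1ℤ → h w ≡ h u ℤ.+ 1ℤ → j w ≡ 2 * j u ∸ 1 → Edge ℓ u w
  lower₂ : h u ℤ.≤ -1ℤ → h w ≡ h u ℤ.+ 1ℤ → j w ≡ 2 * j u     → Edge ℓ u w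
  roots  : h u ≡ + ℓ → j u ≡ 1 → h w ≡ - (+ ℓ) → j w ≡ 1 → Edge ℓ u w
  leaves : (i : ℕ) → 1 ≤ i → i ≤ 2 ^ (ℓ ∸ 1) →
           h u ≡ 0ℤ → j u ≡ 2 * i ∸ 1 → h w ≡ 0ℤ → j w ≡ 2 * i → Edge ℓ u w

H : (ℓ : ℕ) → Rel (Vertex ℓ) 0ℓ
H ℓ = SymClosure (Edge ℓ)

record Path {V : Set} (_~_ : Rel V 0ℓ) : Set where
  field
    start    : V
    rest     : List V
    linked   : Linked _~_ (start ∷ rest)
    distinct : Unique (start ∷ rest)

  -- number of edges
  length : ℕ
  length = List.length rest

{-# OPTIONS --safe #-}

-- For k ≤ ℓ let D(k,i) be the copy of H_k (without its root edge) spanned by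
-- v_{k,i}, v_{-k,i} and everything between them; D(k+1,i) is made of its two
-- roots and of the two disjoint copies D(k,2i-1) and D(k,2i).  If k ≥ 1, then
-- D(k,a) is joined to the rest of the graph only through the two roots of the
-- copy D(k+1,⌈a/2⌉) around it.  A path which meets both halves of D(k+1,i) and
-- has no endpoint in them would have to leave each half through a root other
-- than the one by which it entered, and so would use one of the roots twice.
-- Hence a path with e endpoints in D(k,i) has at most 2k + 2 + e(k² + k - 2)
-- vertices there, by induction on k ≥ 1; take k = ℓ and e ≤ 2.
module Submission where

open import Defs
open import Data.Empty using (⊥-elim)
open import Data.Integer as ℤ using (ℤ; +_; -_; -[1+_]; ∣_∣; 1ℤ; -1ℤ)
import Data.Integer.Properties as ℤ
open import Data.List.Base using (List; []; _∷_; length; filter)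
open import Data.List.Properties using (filter-all; filter-none; filter-some; length-filter)
open import Data.List.Membership.Propositional using (_∈_)
open import Data.List.Relation.Unary.All as All using (_∷_)
open import Data.List.Relation.Unary.All.Properties using (¬Any⇒All¬)
open import Data.List.Relation.Unary.AllPairs using (_∷_)
open import Data.List.Relation.Unary.Any using (Any; here; there; any?)
open import Data.List.Relation.Unary.Linked using (Linked; [-]; _∷_)
open import Data.List.Relation.Unary.Unique.Propositional using (Unique)
open import Data.Nat.Base using (ℕ; zero; suc; pred; _+_; _*_; _∸_; _^_; _≤_; _<_; z≤n; s≤s; ⌈_/2⌉)
open import Data.Nat.Properties
open import Data.Nat.Tactic.RingSolver using (solve-∀)
open import Data.Product using (∃₂; _×_; _,_; proj₁; proj₂)
open import Data.Sum as Sum using (_⊎_; inj₁; inj₂; [_,_]′)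
open import Function using (_∘_; id)
open import Level using (0ℓ)
open import Relation.Binary.Construct.Closure.Symmetric using (fwd; bwd; symmetric)
open import Relation.Binary.Core using (Rel)
open import Relation.Binary.Definitions using (Symmetric)
open import Relation.Binary.PropositionalEquality using (_≡_; _≢_; refl; sym; trans; cong; subst)
open import Relation.Nullary using (¬_; yes; no; contradiction)
open import Relation.Nullary.Decidable using (map′; recompute; _×-dec_)
open import Relation.Unary using (Pred; Decidable; _⊆_; _∪_; _⊥_)
open import Relation.Unary.Properties using (_∪?_)

-- Counting the entries of a list that satisfy a predicate.

module _ {V : Set} where

  # : {P : Pred V 0ℓ} → Decidable P → List V → ℕ
  # P? xs = length (filter P? xs)

  module _ {P Q R : Pred V 0ℓ} (P? : Decidable P) (Q? : Decidable Q) (R? : Decidable R) where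

    #-∪≤ : P ⊆ Q ∪ R → ∀ xs → # P? xs ≤ # Q? xs + # R? xs
    #-∪≤ P⊆ []       = z≤n
    #-∪≤ P⊆ (x ∷ xs) with #-∪≤ P⊆ xs | P? x | Q? x | R? x
    ... | ih | yes p | no ¬q | no ¬r = contradiction (P⊆ p) [ ¬q , ¬r ]′
    ... | ih | no _  | no _  | no _  = ih
    ... | ih | yes _ | yes _ | no _  = s≤s ih
    ... | ih | no _  | yes _ | no _  = m≤n⇒m≤1+n ih
    ... | ih | yes _ | no _  | yes _ rewrite +-suc (# Q? xs) (# R? xs) = s≤s ih
    ... | ih | no _  | no _  | yes _ rewrite +-suc (# Q? xs) (# R? xs) = m≤n⇒m≤1+n ih
    ... | ih | yes _ | yes _ | yes _ rewrite +-suc (# Q? xs) (# R? xs) = s≤s (m≤n⇒m≤1+n ih)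
    ... | ih | no _  | yes _ | yes _ rewrite +-suc (# Q? xs) (# R? xs) = m≤n⇒m≤1+n (m≤n⇒m≤1+n ih)

    #-disjoint : Q ⊥ R → Q ⊆ P → R ⊆ P → ∀ xs → # Q? xs + # R? xs ≤ # P? xs
    #-disjoint Q⊥R Q⊆ R⊆ []       = z≤n
    #-disjoint Q⊥R Q⊆ R⊆ (x ∷ xs) with #-disjoint Q⊥R Q⊆ R⊆ xs | P? x | Q? x | R? x
    ... | ih | _     | yes q | yes r = ⊥-elim (Q⊥R (q , r))
    ... | ih | no ¬p | yes q | no _  = contradiction (Q⊆ q) ¬p
    ... | ih | no ¬p | no _  | yes r = contradiction (R⊆ r) ¬p
    ... | ih | no _  | no _  | no _  = ih
    ... | ih | yes _ | no _  | no _  = m≤n⇒m≤1+n ih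
    ... | ih | yes _ | yes _ | no _  = s≤s ih
    ... | ih | yes _ | no _  | yes _ rewrite +-suc (# Q? xs) (# R? xs) = s≤s ih

  #-unique : {P : Pred V 0ℓ} (P? : Decidable P) → (∀ {u v} → P u → P v → u ≡ v) →
             ∀ {xs} → Unique xs → # P? xs ≤ 1
  #-unique P? P-prop {[]}     _           = z≤n
  #-unique P? P-prop {x ∷ xs} (x∉xs ∷ uq) with P? x
  ... | no _  = #-unique P? P-prop uq
  ... | yes p rewrite filter-none P? (All.map (λ x≢y q → x≢y (P-prop p q)) x∉xs) = ≤-refl

  -- Visits of a path to a set of vertices.

  final : V → List V → V
  final x []       = x
  final _ (y ∷ ys) = final y ys

  -- u is directly followed by a vertex of A, and v comes later.
  data Visit (A : Pred V 0ℓ) (u v : V) : List V → Set where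
    here  : ∀ {w xs} → A w → v ∈ xs → Visit A u v (u ∷ w ∷ xs)
    there : ∀ {x xs} → Visit A u v xs → Visit A u v (x ∷ xs)

  module _ {A : Pred V 0ℓ} {u v : V} where

    visit⇒first∈ : ∀ {xs} → Visit A u v xs → u ∈ xs
    visit⇒first∈ (here _ _) = here refl
    visit⇒first∈ (there vs) = there (visit⇒first∈ vs)

    visit⇒second∈ : ∀ {xs} → Visit A u v xs → v ∈ xs
    visit⇒second∈ (here _ v∈) = there (there v∈)
    visit⇒second∈ (there vs)  = there (visit⇒second∈ vs)

    visit⇒≢ : ∀ {xs} → Unique xs → Visit A u v xs → u ≢ v
    visit⇒≢ (u∉ ∷ _) (here _ v∈) = All.lookup u∉ (there v∈)
    visit⇒≢ (_ ∷ uq) (there vs)  = visit⇒≢ uq vs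

  -- Without repetitions the successor of `u` is determined, and it would lie in both `A` and `B`.
  visits-same-first : ∀ {A B : Pred V 0ℓ} {u v v′ xs} → Unique xs → A ⊥ B →
                      Visit A u v xs → ¬ Visit B u v′ xs
  visits-same-first uq       A⊥B (here a _) (here b _) = A⊥B (a , b)
  visits-same-first (u∉ ∷ _) A⊥B (here _ _) (there vs) = All.lookup u∉ (visit⇒first∈ vs) refl
  visits-same-first (u∉ ∷ _) A⊥B (there vs) (here _ _) = All.lookup u∉ (visit⇒first∈ vs) refl
  visits-same-first (_ ∷ uq) A⊥B (there vs) (there ws) = visits-same-first uq A⊥B vs ws

  -- Without repetitions two entries come in only one order; the sets visited do not matter.
  visits-opposite : ∀ {A B : Pred V 0ℓ} {u v xs} → Unique xs →
                    Visit A u v xs → ¬ Visit B v u xs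
  visits-opposite (u∉ ∷ _) (here _ v∈) (here _ _) = All.lookup u∉ (there v∈) refl
  visits-opposite (u∉ ∷ _) (here _ _)  (there ws) = All.lookup u∉ (visit⇒second∈ ws) refl
  visits-opposite (v∉ ∷ _) (there vs)  (here _ _) = All.lookup v∉ (visit⇒second∈ vs) refl
  visits-opposite (_ ∷ uq) (there vs)  (there ws) = visits-opposite uq vs ws

  module _ {_~_ : Rel V 0ℓ} (~-sym : Symmetric _~_) {A G : Pred V 0ℓ} (A? : Decidable A)
           (gate : ∀ {u w} → u ~ w → ¬ A u → A w → G u) where

    -- The first vertex outside `A` has a neighbour in `A`, so `gate` applies to that edge read
    -- backwards.
    exit : ∀ {x xs} → Linked _~_ (x ∷ xs) → A x → ¬ A (final x xs) → ∃₂ λ v (_ : v ∈ xs) → G v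
    exit [-]                a ¬last = contradiction a ¬last
    exit {xs = y ∷ _} (x~y ∷ ls) a ¬last with A? y
    ... | no ¬a = y , here refl , gate (~-sym x~y) ¬a a
    ... | yes b with exit ls b ¬last
    ...   | v , v∈ , g = v , there v∈ , g

    -- The first edge into `A` starts at a gate. As the path does not end in `A`, `exit` then finds
    -- a second gate further on.
    visit : ∀ {x xs} → Linked _~_ (x ∷ xs) → ¬ A x → ¬ A (final x xs) → Any A (x ∷ xs) →
            ∃₂ λ u v → G u × G v × Visit A u v (x ∷ xs)
    visit _  ¬a _ (here a) = contradiction a ¬a
    visit {x} {y ∷ _} (x~y ∷ ls) ¬a ¬last (there any) with A? y
    ... | yes b with exit ls b ¬last
    ...   | v , v∈ , g = x , v , gate x~y ¬a b , g , here b v∈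
    visit {x} {y ∷ _} (x~y ∷ ls) ¬a ¬last (there any) | no ¬b with visit ls ¬b ¬last any
    ...   | u , v , gu , gv , vs = u , v , gu , gv , there vs

  -- The gates `u` and `v` of the first visit are distinct, so they are the only gates. The second
  -- visit thus starts at `u`, or goes from `v` back to `u`, or from `v` to `v`; each contradicts
  -- distinctness.
  ¬visit-both : ∀ {A B G : Pred V 0ℓ} {xs} → Unique xs → A ⊥ B →
                (∀ {a b c} → G a → G b → G c → a ≢ b → c ≡ a ⊎ c ≡ b) →
                (∃₂ λ u v → G u × G v × Visit A u v xs) →
                ¬ (∃₂ λ u v → G u × G v × Visit B u v xs)
  ¬visit-both uq A⊥B two (u , v , gu , gv , vs) (u′ , v′ , gu′ , gv′ , ws)
    with two gu gv gu′ (visit⇒≢ uq vs) | two gu gv gv′ (visit⇒≢ uq vs)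
  ... | inj₁ refl | _         = visits-same-first uq A⊥B vs ws
  ... | inj₂ refl | inj₁ refl = visits-opposite uq vs ws
  ... | inj₂ refl | inj₂ refl = visit⇒≢ uq ws refl

-- Indices in a binary tree and absolute values of levels.

⌈2*n/2⌉≡n : ∀ n → ⌈ 2 * n /2⌉ ≡ n
⌈2*n/2⌉≡n n rewrite +-identityʳ n = sym (n≡⌈n+n/2⌉ n)

⌈2*n∸1/2⌉≡n : ∀ n → ⌈ 2 * n ∸ 1 /2⌉ ≡ n
⌈2*n∸1/2⌉≡n zero    = refl
-- `⌈ m /2⌉` unfolds to `⌊ suc m /2⌋`, which makes up for the subtracted 1.
⌈2*n∸1/2⌉≡n (suc n) rewrite +-identityʳ n = sym (n≡⌊n+n/2⌋ (suc n))

half⁻¹ : ∀ n → n ≡ 2 * ⌈ n /2⌉ ∸ 1 ⊎ n ≡ 2 * ⌈ n /2⌉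
half⁻¹ n = Sum.map₁ (cong pred) (go n)
  where
  -- Moving the 1 to the left avoids truncated subtraction, so both sides simply grow by 2.
  go : ∀ n → suc n ≡ 2 * ⌈ n /2⌉ ⊎ n ≡ 2 * ⌈ n /2⌉
  go 0             = inj₂ refl
  go 1             = inj₁ refl
  go (suc (suc n)) rewrite *-suc 2 ⌈ n /2⌉ = Sum.map (cong (suc ∘ suc)) (cong (suc ∘ suc)) (go n)

-- The children of index `a` have indices `2a - 1` and `2a`, which both halve to `a` when rounded
-- up. So this is the index `m` levels further towards the root, in either tree.
ancestor : ℕ → ℕ → ℕ
ancestor zero    j = j
ancestor (suc m) j = ⌈ ancestor m j /2⌉

ancestor-half : ∀ m j → ancestor m ⌈ j /2⌉ ≡ ⌈ ancestor m j /2⌉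
ancestor-half zero    j = refl
ancestor-half (suc m) j = cong ⌈_/2⌉ (ancestor-half m j)

ancestor-top : ∀ m {j} → 1 ≤ j → j ≤ 2 ^ m → ancestor m j ≡ 1
ancestor-top zero    1≤j j≤ = ≤-antisym j≤ 1≤j
ancestor-top (suc m) {j} 1≤j j≤ = trans (sym (ancestor-half m j))
  (ancestor-top m (⌈n/2⌉-mono 1≤j) (subst (⌈ j /2⌉ ≤_) (⌈2*n/2⌉≡n (2 ^ m)) (⌈n/2⌉-mono j≤)))

∣i∣-above : ∀ {i k} → 1ℤ ℤ.≤ i → k ≡ i ℤ.- 1ℤ → ∣ i ∣ ≡ suc ∣ k ∣
∣i∣-above {+ suc n} _ refl = refl
∣i∣-above {+ zero} (ℤ.+≤+ ()) _

∣i∣-below : ∀ {i k} → i ℤ.≤ -1ℤ → k ≡ i ℤ.+ 1ℤ → ∣ i ∣ ≡ suc ∣ k ∣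
∣i∣-below { -[1+ zero ]}  _ refl = refl
∣i∣-below { -[1+ suc n ]} _ refl = refl

∣i∣≤ : ∀ {i n} → - (+ n) ℤ.≤ i → i ℤ.≤ + n → ∣ i ∣ ≤ n
∣i∣≤ {+ m} _ (ℤ.+≤+ m≤n) = m≤n
∣i∣≤ { -[1+ m ]} {suc n} (ℤ.-≤- m≤n) _ = s≤s m≤n

∣i∣≡∣j∣⇒i≡±j : ∀ {i j} → ∣ i ∣ ≡ ∣ j ∣ → i ≡ j ⊎ i ≡ - j
∣i∣≡∣j∣⇒i≡±j {+ m}     {+ n}      refl = inj₁ refl
∣i∣≡∣j∣⇒i≡±j {+ m}     { -[1+ n ]} refl = inj₂ refl
∣i∣≡∣j∣⇒i≡±j { -[1+ m ]} {+ n}      refl = inj₂ refl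
∣i∣≡∣j∣⇒i≡±j { -[1+ m ]} { -[1+ n ]} refl = inj₁ refl

-- Diamonds, the copies D(k,i), and their roots.

module _ {ℓ : ℕ} where

  vertex≡ : {u v : Vertex ℓ} → h u ≡ h v → j u ≡ j v → u ≡ v
  vertex≡ {vertex _ _ _ _ _ _} {vertex _ _ _ _ _ _} refl refl = refl

  -- The sign of the level is dropped because diamonds are symmetric in it; this merges the edges of
  -- the two trees.
  Parent : Rel (Vertex ℓ) 0ℓ
  Parent u w = ∣ h u ∣ ≡ suc ∣ h w ∣ × j u ≡ ⌈ j w /2⌉

  data Step (u w : Vertex ℓ) : Set where
    parent : Parent u w → Step u w
    root   : ∣ h w ∣ ≡ ℓ → ∣ h u ∣ ≡ ℓ → Step u w
    leaf   : ∣ h u ∣ ≡ 0 → ∣ h w ∣ ≡ 0 → ⌈ j u /2⌉ ≡ ⌈ j w /2⌉ → Step u w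

  step : ∀ {u w} → Edge ℓ u w → Step u w
  step {u} (upper₁ p q r) = parent (∣i∣-above p q , sym (trans (cong ⌈_/2⌉ r) (⌈2*n∸1/2⌉≡n (j u))))
  step {u} (upper₂ p q r) = parent (∣i∣-above p q , sym (trans (cong ⌈_/2⌉ r) (⌈2*n/2⌉≡n (j u))))
  step {u} (lower₁ p q r) = parent (∣i∣-below p q , sym (trans (cong ⌈_/2⌉ r) (⌈2*n∸1/2⌉≡n (j u))))
  step {u} (lower₂ p q r) = parent (∣i∣-below p q , sym (trans (cong ⌈_/2⌉ r) (⌈2*n/2⌉≡n (j u))))
  step (roots p _ q _) = root (trans (cong ∣_∣ q) (ℤ.∣-i∣≡∣i∣ (+ ℓ))) (cong ∣_∣ p)
  step (leaves i _ _ p q r s) = leaf (cong ∣_∣ p) (cong ∣_∣ r)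
    (trans (cong ⌈_/2⌉ q) (trans (⌈2*n∸1/2⌉≡n i) (sym (trans (cong ⌈_/2⌉ s) (⌈2*n/2⌉≡n i)))))

  -- D(k,i) read off from coordinates: the ancestor at level `k` has index `i`. The first field
  -- makes the truncated subtraction in the second exact. For `k = 0` only a leaf is left.
  record Diamond (k i : ℕ) (v : Vertex ℓ) : Set where
    constructor ⟨_,_⟩
    field
      level≤k    : ∣ h v ∣ ≤ k
      ancestor≡i : ancestor (k ∸ ∣ h v ∣) (j v) ≡ i

  open Diamond

  diamond? : ∀ k i → Decidable (Diamond k i)
  diamond? k i v = map′ (λ (p , q) → ⟨ p , q ⟩) (λ d → level≤k d , ancestor≡i d)
    (∣ h v ∣ ≤? k ×-dec ancestor (k ∸ ∣ h v ∣) (j v) ≟ i)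

  Root : ℕ → ℕ → Pred (Vertex ℓ) 0ℓ
  Root k i v = ∣ h v ∣ ≡ k × j v ≡ i

  diamond-disjoint : ∀ {k a b} → a ≢ b → Diamond k a ⊥ Diamond k b
  diamond-disjoint a≢b (⟨ _ , p ⟩ , ⟨ _ , q ⟩) = a≢b (trans (sym p) q)

  diamond-up : ∀ {k a} → Diamond k a ⊆ Diamond (suc k) ⌈ a /2⌉
  diamond-up {x = v} ⟨ h≤k , p ⟩ = ⟨ m≤n⇒m≤1+n h≤k ,
    trans (cong (λ m → ancestor m (j v)) (+-∸-assoc 1 h≤k)) (cong ⌈_/2⌉ p) ⟩

  -- Below level `suc k`, the ancestor at level `k` has an index whose half, rounded up, is `i`;
  -- `half⁻¹` leaves two values for it.
  diamond-down : ∀ {k i} → Diamond (suc k) i ⊆ Root (suc k) i ∪ (Diamond k (2 * i ∸ 1) ∪ Diamond k (2 * i))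
  diamond-down {k} {i} {v} ⟨ h≤ , p ⟩ with m≤n⇒m<n∨m≡n h≤
  ... | inj₂ h≡ rewrite h≡ | n∸n≡0 k = inj₁ (refl , p)
  ... | inj₁ (s≤s h≤k) rewrite +-∸-assoc 1 h≤k =
    inj₂ (Sum.map (λ q → ⟨ h≤k , trans q (cong (λ n → 2 * n ∸ 1) p) ⟩) (λ q → ⟨ h≤k , trans q (cong (2 *_) p) ⟩)
      (half⁻¹ (ancestor (k ∸ ∣ h v ∣) (j v))))

  diamond-top : ∀ v → Diamond ℓ 1 v
  diamond-top (vertex h j -ℓ≤h h≤ℓ 1≤j j≤) = ⟨
    -- The bounds of a vertex are irrelevant, but decidable consequences of them can be recomputed.
    recompute (∣ h ∣ ≤? ℓ) (∣i∣≤ -ℓ≤h h≤ℓ) ,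
    recompute (ancestor (ℓ ∸ ∣ h ∣) j ≟ 1) (ancestor-top (ℓ ∸ ∣ h ∣) 1≤j j≤) ⟩

  diamond-leaf-unique : ∀ {i u v} → Diamond 0 i u → Diamond 0 i v → u ≡ v
  diamond-leaf-unique {i} {u} {v} ⟨ hu , p ⟩ ⟨ hv , q ⟩ =
    vertex≡ (trans hu≡0 (sym hv≡0)) (trans (at-0 u hu≡0 p) (sym (at-0 v hv≡0 q)))
    where
    hu≡0 = ℤ.∣i∣≡0⇒i≡0 (n≤0⇒n≡0 hu)
    hv≡0 = ℤ.∣i∣≡0⇒i≡0 (n≤0⇒n≡0 hv)
    at-0 : ∀ w → h w ≡ + 0 → ancestor (0 ∸ ∣ h w ∣) (j w) ≡ i → j w ≡ i
    at-0 w hw≡0 r rewrite hw≡0 = r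

  module _ {u w : Vertex ℓ} (u↓w : Parent u w) where

    parent-ancestor : ∀ {k} → ∣ h u ∣ ≤ k → ancestor (k ∸ ∣ h u ∣) (j u) ≡ ancestor (k ∸ ∣ h w ∣) (j w)
    parent-ancestor hu≤k rewrite proj₁ u↓w | proj₂ u↓w with hu≤k
    ... | s≤s {n = k} hw≤k rewrite +-∸-assoc 1 hw≤k = ancestor-half (k ∸ ∣ h w ∣) (j w)

    parent∈ : ∀ {k a} → ∣ h w ∣ < k → Diamond k a w → Diamond k a u
    parent∈ {k} hw<k ⟨ _ , p ⟩ = ⟨ hu≤k , trans (parent-ancestor hu≤k) p ⟩
      where hu≤k = subst (_≤ k) (sym (proj₁ u↓w)) hw<k

    child∈ : ∀ {k a} → Diamond k a u → Diamond k a w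
    child∈ {k} ⟨ hu≤k , p ⟩ =
      ⟨ <⇒≤ (subst (_≤ k) (proj₁ u↓w) hu≤k) , trans (sym (parent-ancestor hu≤k)) p ⟩

  -- Matched leaves agree from their first ancestor on, hence the condition `1 ≤ k`.
  leaf∈ : ∀ {u w k a} → 1 ≤ k → ∣ h u ∣ ≡ 0 → ∣ h w ∣ ≡ 0 → ⌈ j u /2⌉ ≡ ⌈ j w /2⌉ →
          Diamond k a w → Diamond k a u
  leaf∈ {u} {w} {k} 1≤k hu≡0 hw≡0 ju≈jw ⟨ _ , p ⟩ =
    ⟨ ≤-trans (≤-reflexive hu≡0) z≤n , trans (same 1≤k hu≡0 hw≡0) p ⟩
    where
    same : ∀ {k a b} → 1 ≤ k → a ≡ 0 → b ≡ 0 → ancestor (k ∸ a) (j u) ≡ ancestor (k ∸ b) (j w)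
    same {suc k} _ refl refl =
      trans (sym (ancestor-half k (j u))) (trans (cong (ancestor k) ju≈jw) (ancestor-half k (j w)))

  -- The edge between the roots of the graph lies at level `ℓ`, above `k`. Matching edges and edges
  -- down to a child stay inside the diamond. An edge up to a parent leaves it only from level `k`,
  -- and then reaches a root of the surrounding diamond.
  gate : ∀ {k a} → 1 ≤ k → k < ℓ → ∀ {u w} → H ℓ u w → ¬ Diamond k a u → Diamond k a w →
         Root (suc k) ⌈ a /2⌉ u
  gate {k} {a} 1≤k k<ℓ {u} {w} u~w u∉ w∈ = go u~w
    where
    go : H ℓ u w → Root (suc k) ⌈ a /2⌉ u
    go (fwd e) with step e
    ... | root hw _      = contradiction (subst (_≤ k) hw (level≤k w∈)) (<⇒≱ k<ℓ)
    ... | leaf hu hw eq  = contradiction (leaf∈ 1≤k hu hw eq w∈) u∉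
    ... | parent u↓w     with m≤n⇒m<n∨m≡n (level≤k w∈)
    ...   | inj₁ hw<k = contradiction (parent∈ u↓w hw<k w∈) u∉
    ...   | inj₂ hw≡k = trans (proj₁ u↓w) (cong suc hw≡k) , trans (proj₂ u↓w) (cong ⌈_/2⌉ jw≡a)
      where
      jw≡a : j w ≡ a
      jw≡a = trans (cong (λ m → ancestor m (j w)) (sym (trans (cong (k ∸_) hw≡k) (n∸n≡0 k)))) (ancestor≡i w∈)
    go (bwd e) with step e
    ... | root _ hw      = contradiction (subst (_≤ k) hw (level≤k w∈)) (<⇒≱ k<ℓ)
    ... | leaf hw hu eq  = contradiction (leaf∈ 1≤k hu hw (sym eq) w∈) u∉
    ... | parent w↓u     = contradiction (child∈ w↓u w∈) u∉

  two-roots : ∀ {k i a b c} → Root k i a → Root k i b → Root k i c → a ≢ b → c ≡ a ⊎ c ≡ b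
  two-roots {a = a} {b} (ha , ja) (hb , jb) (hc , jc) a≢b
    with ∣i∣≡∣j∣⇒i≡±j (trans hc (sym ha)) | ∣i∣≡∣j∣⇒i≡±j (trans hc (sym hb))
  ... | inj₁ eq | _       = inj₁ (vertex≡ eq (trans jc (sym ja)))
  ... | _       | inj₁ eq = inj₂ (vertex≡ eq (trans jc (sym jb)))
  -- If the level of `c` is opposite to those of both `a` and `b`, then `a` and `b` coincide.
  ... | inj₂ p  | inj₂ q  =
    contradiction (vertex≡ (ℤ.neg-injective (trans (sym p) q)) (trans ja (sym jb))) a≢b

  root? : ∀ k i → Decidable (Root k i)
  root? k i v = ∣ h v ∣ ≟ k ×-dec j v ≟ i

  #-root : ∀ k i {xs} → Unique xs → # (root? k i) xs ≤ 2
  #-root k i {xs} uq = ≤-trans (#-∪≤ (root? k i) (at? (+ k)) (at? (- (+ k))) (λ {v} → split {v}) xs)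
    (+-mono-≤ (#-unique (at? (+ k)) at-unique uq) (#-unique (at? (- (+ k))) at-unique uq))
    where
    At : ℤ → Pred (Vertex ℓ) 0ℓ
    At z v = h v ≡ z × j v ≡ i
    at? : ∀ z → Decidable (At z)
    at? z v = h v ℤ.≟ z ×-dec j v ≟ i
    at-unique : ∀ {z u v} → At z u → At z v → u ≡ v
    at-unique (p , q) (r , s) = vertex≡ (trans p (sym r)) (trans q (sym s))
    split : Root k i ⊆ At (+ k) ∪ At (- (+ k))
    split (p , q) = Sum.map (_, q) (_, q) (∣i∣≡∣j∣⇒i≡±j p)

  untouched : ∀ {k a xs} → ¬ Any (Diamond k a) xs → # (diamond? k a) xs ≡ 0
  untouched {k} {a} {xs} ¬any = cong length (filter-none (diamond? k a) (¬Any⇒All¬ xs ¬any))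

  -- Counting the vertices of a fixed path in a diamond.

  module _ (x : Vertex ℓ) (xs : List (Vertex ℓ))
           (linked : Linked (H ℓ) (x ∷ xs)) (distinct : Unique (x ∷ xs)) where

    -- A path with one vertex has it listed twice. This is harmless: the bounds grow with the number
    -- of ends, and the list always has two entries.
    ends : List (Vertex ℓ)
    ends = x ∷ final x xs ∷ []

    inside endpoints : ℕ → ℕ → ℕ
    inside    k i = # (diamond? k i) (x ∷ xs)
    endpoints k i = # (diamond? k i) ends

    module _ (k i : ℕ) (1≤i : 1 ≤ i) where

      left right : ℕ
      left  = 2 * i ∸ 1
      right = 2 * i

      left≢right : left ≢ right
      -- For `i = 0` truncation would make both indices 0; `1 ≤ i` keeps them apart.
      left≢right = <⇒≢ (m∸1<m (≤-trans 1≤i (m≤n*m i 2)))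
        where
        m∸1<m : ∀ {m} → 1 ≤ m → m ∸ 1 < m
        m∸1<m (s≤s _) = ≤-refl

      endpoints-children : endpoints k left + endpoints k right ≤ endpoints (suc k) i
      endpoints-children = #-disjoint (diamond? (suc k) i) (diamond? k left) (diamond? k right)
        (diamond-disjoint left≢right)
        (subst (λ n → Diamond k left ⊆ Diamond (suc k) n) (⌈2*n∸1/2⌉≡n i) diamond-up)
        (subst (λ n → Diamond k right ⊆ Diamond (suc k) n) (⌈2*n/2⌉≡n i) diamond-up) ends

      inside-children : inside (suc k) i ≤ 2 + (inside k left + inside k right)
      inside-children = ≤-trans
        (#-∪≤ (diamond? (suc k) i) (root? (suc k) i) (diamond? k left ∪? diamond? k right) diamond-down (x ∷ xs))
        (+-mono-≤ (#-root (suc k) i distinct)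
          (#-∪≤ (diamond? k left ∪? diamond? k right) (diamond? k left) (diamond? k right) id (x ∷ xs)))

      visit-child : 1 ≤ k → k < ℓ → ∀ c → ⌈ c /2⌉ ≡ i → ¬ Any (Diamond k c) ends →
                    Any (Diamond k c) (x ∷ xs) →
                    ∃₂ λ u v → Root (suc k) i u × Root (suc k) i v × Visit (Diamond k c) u v (x ∷ xs)
      visit-child 1≤k k<ℓ c refl ¬ends = visit (symmetric (Edge ℓ)) (diamond? k c) (gate 1≤k k<ℓ)
        linked (λ a → ¬ends (here a)) (λ a → ¬ends (there (here a)))

      -- An end in one half is an end in the whole. With no end in either half, the path would visit
      -- both through the same two roots, which `¬visit-both` excludes.
      both-children⇒endpoint : 1 ≤ k → k < ℓ → Any (Diamond k left) (x ∷ xs) → Any (Diamond k right) (x ∷ xs) →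
                               1 ≤ endpoints (suc k) i
      both-children⇒endpoint 1≤k k<ℓ l r
        with any? (diamond? k left) ends | any? (diamond? k right) ends
      ... | yes a | _     = ≤-trans (≤-trans (filter-some (diamond? k left) a) (m≤m+n _ _)) endpoints-children
      ... | _     | yes b = ≤-trans (≤-trans (filter-some (diamond? k right) b) (m≤n+m _ _)) endpoints-children
      ... | no ¬a | no ¬b = contradiction
        (visit-child 1≤k k<ℓ right (⌈2*n/2⌉≡n i) ¬b r)
        (¬visit-both distinct (diamond-disjoint left≢right) two-roots
          (visit-child 1≤k k<ℓ left (⌈2*n∸1/2⌉≡n i) ¬a l))

      -- Here `m` bounds the count when there are no ends, and `q` is the surcharge per end. If both
      -- halves are met, the second `m` is charged to an end, which exists by
      -- `both-children⇒endpoint`; so the surcharge becomes `q + m`. The 2 accounts for the roots.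
      inside-step : 1 ≤ k → k < ℓ → ∀ m q →
                    inside k left  ≤ m + endpoints k left  * q →
                    inside k right ≤ m + endpoints k right * q →
                    inside (suc k) i ≤ 2 + m + endpoints (suc k) i * (q + m)
      inside-step 1≤k k<ℓ m q L R = ≤-trans inside-children (+-monoʳ-≤ 2 children)
        where
        open ≤-Reasoning
        e = endpoints (suc k) i
        eˡ = endpoints k left
        eʳ = endpoints k right
        one-child : inside k left + inside k right ≤ m + e * q → inside k left + inside k right ≤ m + e * (q + m)
        one-child p = ≤-trans p (+-monoʳ-≤ m (*-monoʳ-≤ e (m≤m+n q m)))
        children : inside k left + inside k right ≤ m + e * (q + m)
        children with any? (diamond? k left) (x ∷ xs) | any? (diamond? k right) (x ∷ xs)
        ... | no ¬l | _ = one-child (begin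
          inside k left + inside k right ≡⟨ cong (_+ inside k right) (untouched ¬l) ⟩
          inside k right                 ≤⟨ R ⟩
          m + eʳ * q                     ≤⟨ +-monoʳ-≤ m (*-monoˡ-≤ q (≤-trans (m≤n+m eʳ eˡ) endpoints-children)) ⟩
          m + e * q                      ∎)
        ... | _ | no ¬r = one-child (begin
          inside k left + inside k right ≡⟨ cong (λ n → inside k left + n) (untouched ¬r) ⟩
          inside k left + 0              ≡⟨ +-identityʳ _ ⟩
          inside k left                  ≤⟨ L ⟩
          m + eˡ * q                     ≤⟨ +-monoʳ-≤ m (*-monoˡ-≤ q (≤-trans (m≤m+n eˡ eʳ) endpoints-children)) ⟩
          m + e * q                      ∎)
        ... | yes l | yes r = begin
          inside k left + inside k right ≤⟨ +-mono-≤ L R ⟩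
          (m + eˡ * q) + (m + eʳ * q)    ≡⟨ regroup m eˡ eʳ q ⟩
          -- The second `m` is written `1 * m` so that this 1 can be raised to `e`.
          m + ((eˡ + eʳ) * q + 1 * m)    ≤⟨ +-monoʳ-≤ m (+-mono-≤ (*-monoˡ-≤ q endpoints-children)
                                              (*-monoˡ-≤ m (both-children⇒endpoint 1≤k k<ℓ l r))) ⟩
          m + (e * q + e * m)            ≡⟨ cong (λ n → m + n) (sym (*-distribˡ-+ e q m)) ⟩
          m + e * (q + m)                ∎
          where
          regroup : ∀ m a b q → (m + a * q) + (m + b * q) ≡ m + ((a + b) * q + 1 * m)
          regroup = solve-∀

    inside-leaf : ∀ i → inside 0 i ≤ 1
    inside-leaf i = #-unique (diamond? 0 i) diamond-leaf-unique distinct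

    -- The coefficients solve the recurrences `m ↦ 2 + m` and `q ↦ q + m` with initial values 4 and
    -- 0. The induction starts at level 1, since `gate` fails to apply at level 0.
    inside-bound : ∀ k i → suc k ≤ ℓ → 1 ≤ i →
                   inside (suc k) i ≤ 2 * k + 4 + endpoints (suc k) i * (k * k + 3 * k)
    -- A diamond of level 1 has only two roots and two leaves.
    inside-bound zero i _ 1≤i = ≤-trans (inside-children 0 i 1≤i)
      (≤-trans (+-monoʳ-≤ 2 (+-mono-≤ (inside-leaf _) (inside-leaf _))) (m≤m+n 4 _))
    inside-bound (suc k) i k<ℓ 1≤i = ≤-trans
      (inside-step (suc k) i 1≤i (s≤s z≤n) k<ℓ (2 * k + 4) (k * k + 3 * k)
        (inside-bound k (2 * i ∸ 1) (<⇒≤ k<ℓ) (∸-monoˡ-≤ 1 (*-monoʳ-≤ 2 1≤i)))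
        (inside-bound k (2 * i) (<⇒≤ k<ℓ) (≤-trans 1≤i (m≤n*m i 2))))
      (≤-reflexive (arith k (endpoints (suc (suc k)) i)))
      where
      arith : ∀ k e → 2 + (2 * k + 4) + e * (k * k + 3 * k + (2 * k + 4)) ≡
                      2 * suc k + 4 + e * (suc k * suc k + 3 * suc k)
      arith = solve-∀

theorem4 : (ℓ : ℕ) → 1 ≤ ℓ → (P : Path (H ℓ)) → Path.length P ≤ 2 * ℓ ^ 2 + 4 * ℓ + 7
theorem4 (suc k) _ P = begin
  length rest                                 ≤⟨ n≤1+n _ ⟩
  length (start ∷ rest)                       ≡⟨ cong length (sym (filter-all D? (All.universal diamond-top (start ∷ rest)))) ⟩
  inside start rest linked distinct (suc k) 1 ≤⟨ inside-bound start rest linked distinct k 1 ≤-refl ≤-refl ⟩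
  2 * k + 4 + endpoints start rest linked distinct (suc k) 1 * (k * k + 3 * k)
    ≤⟨ +-monoʳ-≤ (2 * k + 4) (*-monoˡ-≤ (k * k + 3 * k) (length-filter D? (ends start rest linked distinct))) ⟩
  -- For `ℓ = suc k` this number of vertices is `2ℓ² + 4ℓ - 2`, which is 9 below the stated bound.
  2 * k + 4 + 2 * (k * k + 3 * k)             ≤⟨ m≤m+n _ 9 ⟩
  2 * k + 4 + 2 * (k * k + 3 * k) + 9         ≡⟨ arith k ⟩
  2 * suc k ^ 2 + 4 * suc k + 7               ∎
  where
  open Path P hiding (length)
  open ≤-Reasoning hiding (start)
  D? = diamond? (suc k) 1
  -- The power `suc k ^ 2` appears here in its unfolded form.
  arith : ∀ k → 2 * k + 4 + 2 * (k * k + 3 * k) + 9 ≡ 2 * (suc k * (suc k * 1)) + 4 * suc k + 7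
  arith = solve-∀
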